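{- For all positive integers $d,k,n$ there exists $r$ such that $\mathrm{ENSH}^d_k(\underbrace{n\cdots n}_{r})$ does not hold, where $n\cdots n$ is the constant sequence of length $r$ with value $n$.
   Context: Identify $d$ with $\{0,\dots,d-1\}$ and $k$ with $\{0,\dots,k-1\}$; $d^n$ is the set of words of length $n$ over $d$. A variable word over $d$ is a sequence $v$ with entries in $\{0,\dots,d-1\}\cup\{x_0,x_1,\dots\}$, the $x_m$ being variables; the first occurrence of a variable $x_m$ occurring in $v$ is $\min\{t:v(t)=x_m\}$. An $n$-variable word is a variable word in which exactly $n$ variables occur, with the convention that the first occurrences are increasing in the variable index. For a finite $n$-variable word $v$ and $\vec a\in d^n$, $v(\vec a)$ is the word obtained by replacing the $j$-th variable occurring in $v$ (in order of index) by $\vec a(j)$, for all $j<n$. Let $n_0,\dots,n_{r-1}$ be positive integers, $N=n_0+\cdots+n_{r-1}$, and $N_s=\{n_0+\cdots+n_{s-1},\dots,n_0+\cdots+n_s-1\}$ for $s\le r-1$. For $f:d^N\to k$, the sequence $n_0\cdots n_{r-1}$ is sectionally-homogeneous for $f$ if there exist $s\le r-1$ and an $n_s$-variable word $v$ over $d$ of length $N$ such that the set of first occurrences of the variables occurring in $v$ is exactly $N_s$ and $f$ is constant on $\{v(\vec a):\vec a\in d^{n_s}\}$. $\mathrm{ENSH}^d_k(n_0\cdots n_{r-1})$ holds if there exists $f:d^N\to k$ such that $n_0\cdots n_{r-1}$ is not sectionally-homogeneous for $f$. -}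

module Defs where

open import Data.Fin.Base as Fin using (Fin; zero; suc; toℕ)
open import Data.Nat.Base using (ℕ; _+_; _≤_; _<_)
open import Data.Product.Base using (Σ; ∃-syntax; _×_; _,_; proj₁)
open import Data.Vec.Base using (Vec; _∷_; lookup; sum; tabulate)
open import Level using (0ℓ)
open import Relation.Binary.PropositionalEquality using (_≡_; _≢_; refl)
open import Relation.Nullary.Negation.Core using (¬_)
open import Relation.Unary using (Pred; _≐_)

-- con c is the letter c of the alphabet, var m is the variable x_m.
data Symbol (d : ℕ) : Set where
  con : Fin d → Symbol d
  var : ℕ → Symbol d

Word : ℕ → ℕ → Set
Word d N = Vec (Fin d) N

VariableWord : ℕ → ℕ → Set
VariableWord d N = Vec (Symbol d) N

module _ {d N : ℕ} (v : VariableWord d N) where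

  Occurs : ℕ → Set
  Occurs m = ∃[ t ] lookup v t ≡ var m

  IsFirstOccurrence : ℕ → Fin N → Set
  IsFirstOccurrence m t =
    lookup v t ≡ var m × (∀ t′ → t′ Fin.< t → lookup v t′ ≢ var m)

  FirstOccurrences : Pred (Fin N) 0ℓ
  FirstOccurrences t = ∃[ m ] IsFirstOccurrence m t

-- "Exactly n variables occur" is given by the (unique) increasing enumeration
-- of the indices of the variables that occur; they need not be x_0, …, x_{n-1}.
record NVariableWord (d n N : ℕ) : Set where
  field
    word           : VariableWord d N
    index          : Fin n → ℕ
    index-mono     : ∀ {i j} → i Fin.< j → index i < index j
    index-occurs   : ∀ j → Occurs word (index j)
    index-complete : ∀ {m} → Occurs word m → ∃[ j ] index j ≡ m
    first-mono     : ∀ {m m′ t t′} → m < m′ →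
                     IsFirstOccurrence word m t →
                     IsFirstOccurrence word m′ t′ →
                     t Fin.< t′

open NVariableWord public

fill : ∀ {d n} (x : Symbol d) → (∀ {m} → x ≡ var m → Fin n) → Word d n → Fin d
fill (con c) position a = c
fill (var m) position a = lookup a (position refl)

-- v ⟨ a ⟩ is v(a): the j-th occurring variable, x_{index v j}, becomes a(j).
_⟨_⟩ : ∀ {d n N} → NVariableWord d n N → Word d n → Word d N
v ⟨ a ⟩ = tabulate λ t →
  fill (lookup (word v) t) (λ eq → proj₁ (index-complete v (t , eq))) a

-- n_0 + ⋯ + n_{s-1}
offset : ∀ {r} → Vec ℕ r → Fin r → ℕ
offset (n ∷ ns) zero    = 0
offset (n ∷ ns) (suc s) = n + offset ns s

-- The set N_s.
Section : ∀ {r} (ns : Vec ℕ r) → Fin r → Pred (Fin (sum ns)) 0ℓ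
Section ns s t = offset ns s ≤ toℕ t × toℕ t < offset ns s + lookup ns s

SectionallyHomogeneous : ∀ {d k r} (ns : Vec ℕ r) →
                         (Word d (sum ns) → Fin k) → Set
SectionallyHomogeneous {d} {k} {r} ns f =
  Σ (Fin r) λ s →
  Σ (NVariableWord d (lookup ns s) (sum ns)) λ v →
    FirstOccurrences (word v) ≐ Section ns s ×
    (∀ a b → f (v ⟨ a ⟩) ≡ f (v ⟨ b ⟩))

ENSH : (d k : ℕ) → ∀ {r} → Vec ℕ r → Set
ENSH d k ns =
  Σ (Word d (sum ns) → Fin k) λ f → ¬ SectionallyHomogeneous ns f

{-# OPTIONS --safe #-}
-- Read a word of length r n over d as a word of length r over the alphabet d^n.
-- A Hales–Jewett line over d^n becomes an n-variable word once every occurrence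
-- of its variable is replaced by the block x_0 ⋯ x_{n-1}, and the first
-- occurrences of x_0, …, x_{n-1} then fill the first such block.  So r can be
-- any Hales–Jewett number for d^n letters and k colours; that theorem is proved
-- by colour focusing.
module Submission where

open import Data.Nat.Base using (ℕ; NonZero)
open import Data.Product.Base using (∃-syntax)
open import Data.Vec.Base using (replicate)
open import Relation.Nullary.Negation.Core using (¬_)
open import Defs

open import Data.Empty using (⊥-elim)
open import Data.Fin.Base as Fin using (Fin; zero; suc; toℕ; fromℕ<; combine; remQuot; funToFin; finToFun)
open import Data.Fin.Properties as Fin using (any?; _≟_)
open import Data.Maybe.Base as Maybe using (Maybe; just; nothing; fromMaybe)
open import Data.Nat.Base using (zero; suc; _+_; _*_; _∸_; _^_; _≤_; _<_; s≤s)
import Data.Nat.Properties as ℕ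
open import Data.Product.Base using (Σ; _×_; _,_; proj₁; proj₂)
open import Data.Sum.Base using (_⊎_; inj₁; inj₂)
open import Data.Vec.Base using (Vec; []; _∷_; _++_; map; lookup; sum; tabulate)
open import Data.Vec.Membership.Propositional using (_∈_)
open import Data.Vec.Membership.Propositional.Properties using (∈-map⁺; ∈-++⁺ˡ; ∈-++⁺ʳ)
open import Data.Vec.Properties
  using (map-++; map-∘; map-cong; map-id; tabulate-cong; tabulate∘lookup;
         lookup∘tabulate; lookup-map; lookup-replicate)
open import Data.Vec.Relation.Unary.Any using (here; there)
open import Function.Base using (_∘_)
open import Function.Definitions using (Injective)
open import Relation.Binary.Definitions using (tri<; tri≈; tri>)
open import Relation.Binary.PropositionalEquality
  using (_≡_; _≢_; _≗_; refl; sym; trans; cong; subst; subst₂; module ≡-Reasoning)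
open import Relation.Nullary.Decidable.Core using (yes; no)
open import Relation.Nullary.Negation.Core using (contradiction)
open import Relation.Unary using (_≐_)

private
  variable
    d k m n q r M N : ℕ

-- The Hales–Jewett theorem

-- nothing is the variable of the line.
record Line (q N : ℕ) : Set where
  field
    template : Vec (Maybe (Fin q)) N
    wildcard : nothing ∈ template

open Line

infix 9 _⟪_⟫
_⟪_⟫ : Line q N → Fin q → Word q N
L ⟪ a ⟫ = map (fromMaybe a) (template L)

MonochromaticLine : (Word q N → Fin k) → Set
MonochromaticLine {q} {N} χ =
  Σ (Line q N) λ L → ∀ a b → χ (L ⟪ a ⟫) ≡ χ (L ⟪ b ⟫)

HalesJewett : ℕ → Set
HalesJewett q = ∀ k → ∃[ N ] ((χ : Word q N → Fin k) → MonochromaticLine χ)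

-- `zero` is the new letter and `suc` embeds the old alphabet. So `weaken L` repeats the points of
-- `L` at the old letters and gains one extra point at `zero`, from which focuses are built.
weaken : Line q N → Line (suc q) N
weaken L .template = map (Maybe.map suc) (template L)
weaken L .wildcard = ∈-map⁺ (Maybe.map suc) (wildcard L)

prefix : Word q M → Line q N → Line q (M + N)
prefix u L .template = map just u ++ template L
prefix u L .wildcard = ∈-++⁺ʳ (map just u) (wildcard L)

suffix : Line q M → Word q N → Line q (M + N)
suffix L w .template = template L ++ map just w
suffix L w .wildcard = ∈-++⁺ˡ (wildcard L)

diagonal : Line q M → Line q N → Line q (M + N)
diagonal L L′ .template = template L ++ template L′
diagonal L L′ .wildcard = ∈-++⁺ˡ (wildcard L)

map-fromMaybe-just : (a : Fin q) (w : Word q N) → map (fromMaybe a) (map just w) ≡ w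
map-fromMaybe-just a w = trans (sym (map-∘ (fromMaybe a) just w)) (map-id w)

weaken-⟪⟫ : (L : Line q N) (a : Fin q) → weaken L ⟪ suc a ⟫ ≡ map suc (L ⟪ a ⟫)
weaken-⟪⟫ L a = begin
  weaken L ⟪ suc a ⟫                                           ≡⟨ map-∘ _ _ (template L) ⟨
  map (λ x → fromMaybe (suc a) (Maybe.map suc x)) (template L) ≡⟨ map-cong fromMaybe-suc (template L) ⟩
  map (λ x → suc (fromMaybe a x)) (template L)                 ≡⟨ map-∘ _ _ (template L) ⟩
  map suc (L ⟪ a ⟫)                                            ∎
  where
  open ≡-Reasoning
  fromMaybe-suc : ∀ x → fromMaybe (suc a) (Maybe.map suc x) ≡ suc (fromMaybe a x)
  fromMaybe-suc nothing  = refl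
  fromMaybe-suc (just _) = refl

prefix-⟪⟫ : (u : Word q M) (L : Line q N) (a : Fin q) → prefix u L ⟪ a ⟫ ≡ u ++ L ⟪ a ⟫
prefix-⟪⟫ u L a =
  trans (map-++ _ (map just u) (template L)) (cong (_++ L ⟪ a ⟫) (map-fromMaybe-just a u))

suffix-⟪⟫ : (L : Line q M) (w : Word q N) (a : Fin q) → suffix L w ⟪ a ⟫ ≡ L ⟪ a ⟫ ++ w
suffix-⟪⟫ L w a =
  trans (map-++ _ (template L) (map just w)) (cong (L ⟪ a ⟫ ++_) (map-fromMaybe-just a w))

diagonal-⟪⟫ : (L : Line q M) (L′ : Line q N) (a : Fin q) →
              diagonal L L′ ⟪ a ⟫ ≡ L ⟪ a ⟫ ++ L′ ⟪ a ⟫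
diagonal-⟪⟫ L L′ a = map-++ _ (template L) (template L′)

-- Coding lets a whole colouring serve as a single colour; points with equal codes then induce the
-- same colouring.
funToFin-injective : {f g : Fin m → Fin n} → funToFin f ≡ funToFin g → f ≗ g
funToFin-injective {f = f} {g} eq i = begin
  f i                       ≡⟨ Fin.finToFun-funToFin f i ⟨
  finToFun (funToFin f) i   ≡⟨ cong (λ c → finToFun c i) eq ⟩
  finToFun (funToFin g) i   ≡⟨ Fin.finToFun-funToFin g i ⟩
  g i                       ∎
  where open ≡-Reasoning

encode : Word d n → Fin (d ^ n)
encode w = funToFin (lookup w)

decode : Fin (d ^ n) → Word d n
decode i = tabulate (finToFun i)

decode-encode : (w : Word d n) → decode (encode w) ≡ w
decode-encode w = trans (tabulate-cong (Fin.finToFun-funToFin (lookup w))) (tabulate∘lookup w)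

-- Colour focusing

record Focused (χ : Word (suc q) N → Fin k) (j : ℕ) : Set where
  field
    focus            : Word (suc q) N
    line             : Fin j → Line (suc q) N
    colour           : Fin j → Fin k
    colour-injective : Injective _≡_ _≡_ colour
    line-focus       : ∀ i → line i ⟪ zero ⟫ ≡ focus
    line-colour      : ∀ i a → χ (line i ⟪ suc a ⟫) ≡ colour i

open Focused

-- The focus is the only point of each line whose colour is left open.
focus-monochromatic : {χ : Word (suc q) N → Fin k} {j : ℕ} (F : Focused χ j) (i : Fin j) →
                      χ (focus F) ≡ colour F i → MonochromaticLine χ
focus-monochromatic {q = q} {χ = χ} F i eq =
  line F i , λ a b → trans (same a) (sym (same b))
  where
  same : ∀ (a : Fin (suc q)) → χ (line F i ⟪ a ⟫) ≡ colour F i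
  same zero    = trans (cong χ (line-focus F i)) eq
  same (suc a) = line-colour F i a

-- By `indep`, a single colouring `χᵤ` of the suffixes describes `χ` behind every old-letter point
-- of `L`.
module _ (χ : Word (suc (suc q)) (M + N) → Fin k) (L : Line (suc q) M)
         (indep : ∀ a b w → χ (map suc (L ⟪ a ⟫) ++ w) ≡ χ (map suc (L ⟪ b ⟫) ++ w))
  where

  private
    u : Word (suc (suc q)) M
    -- This `zero` lies in the smaller alphabet, so `suc` sends it to an old letter; by `indep` any
    -- other choice gives the same colours.
    u = map suc (L ⟪ zero ⟫)

    χᵤ : Word (suc (suc q)) N → Fin k
    χᵤ w = χ (u ++ w)

    weaken-colour : ∀ a w → χ (weaken L ⟪ suc a ⟫ ++ w) ≡ χᵤ w
    weaken-colour a w = trans (cong (λ v → χ (v ++ w)) (weaken-⟪⟫ L a)) (indep a zero w)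

  prefix-monochromatic : MonochromaticLine χᵤ → MonochromaticLine χ
  prefix-monochromatic (L′ , mono) = prefix u L′ , λ a b → begin
    χ (prefix u L′ ⟪ a ⟫)   ≡⟨ cong χ (prefix-⟪⟫ u L′ a) ⟩
    χᵤ (L′ ⟪ a ⟫)           ≡⟨ mono a b ⟩
    χᵤ (L′ ⟪ b ⟫)           ≡⟨ cong χ (prefix-⟪⟫ u L′ b) ⟨
    χ (prefix u L′ ⟪ b ⟫)   ∎
    where open ≡-Reasoning

  -- Each given line now moves together with `L`, which by `indep` preserves its colour. The
  -- additional line moves `L` alone in front of the old focus and has the colour of that focus,
  -- which `new` separates from the rest. At `zero` they all meet.
  extend-focused : ∀ {j} (F : Focused χᵤ j) → (∀ i → χᵤ (focus F) ≢ colour F i) →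
                   Focused χ (suc j)
  extend-focused F new .focus = weaken L ⟪ zero ⟫ ++ focus F
  extend-focused F new .line zero    = suffix (weaken L) (focus F)
  extend-focused F new .line (suc i) = diagonal (weaken L) (line F i)
  extend-focused F new .colour zero    = χᵤ (focus F)
  extend-focused F new .colour (suc i) = colour F i
  extend-focused F new .colour-injective {zero}  {zero}  eq = refl
  extend-focused F new .colour-injective {zero}  {suc i} eq = contradiction eq (new i)
  extend-focused F new .colour-injective {suc i} {zero}  eq = contradiction (sym eq) (new i)
  extend-focused F new .colour-injective {suc i} {suc j} eq = cong suc (colour-injective F eq)
  extend-focused F new .line-focus zero    = suffix-⟪⟫ (weaken L) (focus F) zero
  extend-focused F new .line-focus (suc i) =
    trans (diagonal-⟪⟫ (weaken L) (line F i) zero) (cong (weaken L ⟪ zero ⟫ ++_) (line-focus F i))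
  extend-focused F new .line-colour zero a =
    trans (cong χ (suffix-⟪⟫ (weaken L) (focus F) (suc a))) (weaken-colour a (focus F))
  extend-focused F new .line-colour (suc i) a = begin
    χ (diagonal (weaken L) (line F i) ⟪ suc a ⟫)         ≡⟨ cong χ (diagonal-⟪⟫ (weaken L) (line F i) (suc a)) ⟩
    χ (weaken L ⟪ suc a ⟫ ++ line F i ⟪ suc a ⟫)         ≡⟨ weaken-colour a (line F i ⟪ suc a ⟫) ⟩
    χᵤ (line F i ⟪ suc a ⟫)                              ≡⟨ line-colour F i a ⟩
    colour F i                                           ∎
    where open ≡-Reasoning

  -- If the focus repeats the colour of a line, that line is complete; otherwise its colour is fresh
  -- and the family grows.
  focusing-step : ∀ {j} → MonochromaticLine χᵤ ⊎ Focused χᵤ j →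
                  MonochromaticLine χ ⊎ Focused χ (suc j)
  focusing-step (inj₁ mono) = inj₁ (prefix-monochromatic mono)
  focusing-step (inj₂ F) with any? (λ i → χᵤ (focus F) ≟ colour F i)
  ... | yes (i , eq) = inj₁ (prefix-monochromatic (focus-monochromatic F i eq))
  ... | no  new      = inj₂ (extend-focused F (λ i eq → new (i , eq)))

-- The letters suc a are the old ones: colour each word over them by the colouring
-- it induces on its extensions, of which there are only finitely many.
colour-focusing : HalesJewett (suc q) → ∀ k j →
                  ∃[ N ] ((χ : Word (suc (suc q)) N → Fin k) → MonochromaticLine χ ⊎ Focused χ j)
colour-focusing hj k zero = 0 , λ χ → inj₂ λ where
  .focus               → []
  .line ()
  .colour ()
  .colour-injective {()}
  .line-focus ()
  .line-colour ()
colour-focusing {q} hj k (suc j)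
  with N , focusing ← colour-focusing hj k j
  -- One colour for each `k`-colouring of the words of length `N`, so `N` has to be fixed before
  -- `M`.
  with M , hjM ← hj (k ^ (suc (suc q) ^ N))
  = M + N , λ χ →
    let induced : Word (suc q) M → Fin (suc (suc q) ^ N) → Fin k
        induced u i = χ (map suc u ++ decode i)
        L , mono = hjM (λ u → funToFin (induced u))
        indep a b w = subst (λ w → χ (map suc (L ⟪ a ⟫) ++ w) ≡ χ (map suc (L ⟪ b ⟫) ++ w))
                        (decode-encode w) (funToFin-injective (mono a b) (encode w))
    in focusing-step χ L indep (focusing _)

-- Induction on the alphabet. One letter is a separate base case because the focusing step picks an
-- old letter. Both base cases take length 1, to leave room for the wildcard.
halesJewett : ∀ q → HalesJewett q
halesJewett 0 k = 1 , λ χ → record { template = nothing ∷ [] ; wildcard = here refl } , λ ()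
halesJewett 1 k = 1 , λ χ → record { template = nothing ∷ [] ; wildcard = here refl } ,
                            λ where zero zero → refl
halesJewett (suc (suc q)) k with N , focusing ← colour-focusing (halesJewett (suc q)) k (suc k)
  = N , λ χ → case-focused χ (focusing χ)
  where
  case-focused : ∀ {N} (χ : Word (suc (suc q)) N → Fin k) →
                 MonochromaticLine χ ⊎ Focused χ (suc k) → MonochromaticLine χ
  case-focused χ (inj₁ mono) = mono
  -- Pigeonhole: `suc k` distinct colours do not fit into `Fin k`.
  case-focused χ (inj₂ F)    = ⊥-elim (Fin.<⇒notInjective ℕ.≤-refl (colour-injective F))

-- From lines over d^n to n-variable words over d

-- The first wildcard, not just any, determines the section that receives the first occurrences.
first-index : ∀ {A : Set} {xs : Vec (Maybe A) N} → nothing ∈ xs →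
              Σ (Fin N) λ s → lookup xs s ≡ nothing × (∀ {t} → t Fin.< s → lookup xs t ≢ nothing)
first-index {xs = nothing ∷ xs} _ = zero , refl , λ ()
first-index {xs = just x ∷ xs} (there p) with s , eq , least ← first-index p =
  suc s , eq , suc-least
  where
  suc-least : ∀ {t} → t Fin.< suc s → lookup (just x ∷ xs) t ≢ nothing
  suc-least {zero}  _         ()
  suc-least {suc t} (s≤s t<s) = least t<s

block : ∀ d n → Maybe (Fin (d ^ n)) → Vec (Symbol d) n
block d n nothing  = tabulate (var ∘ toℕ)
block d n (just i) = map con (decode i)

-- This is concatenation of the blocks, given by position so that `combine` and `remQuot` handle all
-- index arithmetic.
expand : ∀ {A B : Set} → (A → Vec B n) → Vec A r → Vec B (r * n)
expand {n} {r} f xs = tabulate λ t → let b , j = remQuot {r} n t in lookup (f (lookup xs b)) j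

lookup-expand : ∀ {A B : Set} (f : A → Vec B n) (xs : Vec A r) b j →
                lookup (expand f xs) (combine b j) ≡ lookup (f (lookup xs b)) j
lookup-expand f xs b j = trans (lookup∘tabulate _ (combine b j))
  (cong (λ (b , j) → lookup (f (lookup xs b)) j) (Fin.remQuot-combine b j))

var-injective : ∀ {m m′} → var {d} m ≡ var m′ → m ≡ m′
var-injective refl = refl

block-var⁻ : ∀ d n (x : Maybe (Fin (d ^ n))) j →
             lookup (block d n x) j ≡ var m → x ≡ nothing × toℕ j ≡ m
block-var⁻ d n nothing  j eq = refl , var-injective (trans (sym (lookup∘tabulate (var ∘ toℕ) j)) eq)
block-var⁻ d n (just i) j eq with () ← trans (sym (lookup-map j con (decode i))) eq

-- The position argument of `fill` depends on its symbol; with the symbol a variable, the equation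
-- can be matched with `refl`.
fill-con : ∀ {x : Symbol d} {p : ∀ {m} → x ≡ var m → Fin n} {a c} → x ≡ con c → fill x p a ≡ c
fill-con refl = refl

fill-var : ∀ {x : Symbol d} {p : ∀ {m} → x ≡ var m → Fin n} {a m} (eq : x ≡ var m) →
           fill x p a ≡ lookup a (p eq)
fill-var refl = refl

module _ (d n : ℕ) (L : Line (d ^ n) r) where

  private
    W : VariableWord d (r * n)
    W = expand (block d n) (template L)

    s : Fin r
    s = proj₁ (first-index (wildcard L))

    nothing-at-s : lookup (template L) s ≡ nothing
    nothing-at-s = proj₁ (proj₂ (first-index (wildcard L)))

    s-least : ∀ {b} → b Fin.< s → lookup (template L) b ≢ nothing
    s-least = proj₂ (proj₂ (first-index (wildcard L)))

  blockIndex : Fin r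
  blockIndex = s

  lookup-var⁻ : ∀ b j {m} → lookup W (combine b j) ≡ var m →
                lookup (template L) b ≡ nothing × toℕ j ≡ m
  lookup-var⁻ b j eq =
    block-var⁻ d n (lookup (template L) b) j
      (trans (sym (lookup-expand (block d n) (template L) b j)) eq)

  lookup-var⁺ : ∀ b j → lookup (template L) b ≡ nothing → lookup W (combine b j) ≡ var (toℕ j)
  lookup-var⁺ b j eq = begin
    lookup W (combine b j)                        ≡⟨ lookup-expand (block d n) (template L) b j ⟩
    lookup (block d n (lookup (template L) b)) j  ≡⟨ cong (λ x → lookup (block d n x) j) eq ⟩
    lookup (tabulate (var ∘ toℕ)) j               ≡⟨ lookup∘tabulate (var ∘ toℕ) j ⟩
    var (toℕ j)                                   ∎
    where open ≡-Reasoning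

  -- All occurrences of one variable have the same offset in their blocks, so an earlier one would
  -- lie in a wildcard block before `s`.
  first⁺ : ∀ j → IsFirstOccurrence W (toℕ j) (combine s j)
  first⁺ j = lookup-var⁺ s j nothing-at-s , earlier
    where
    earlier : ∀ t → t Fin.< combine s j → lookup W t ≢ var (toℕ j)
    earlier t t<sj eq with b , j′ , refl ← Fin.combine-surjective {r} {n} t
      with hole , j′≡j ← lookup-var⁻ b j′ eq
      with refl ← Fin.toℕ-injective j′≡j
      with Fin.<-cmp b s
    ... | tri< b<s _ _  = s-least b<s hole
    ... | tri≈ _ refl _ = ℕ.<-irrefl refl t<sj
    ... | tri> _ _ b>s  = ℕ.<-asym t<sj (Fin.combine-monoˡ-< j j b>s)

  -- A wildcard block after `s` only repeats variables that block `s` already contains at the same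
  -- offsets.
  first⁻ : ∀ {m t} → IsFirstOccurrence W m t → Σ (Fin n) λ j → toℕ j ≡ m × combine s j ≡ t
  first⁻ {m} {t} (eq , least) with b , j , refl ← Fin.combine-surjective {r} {n} t
    with hole , refl ← lookup-var⁻ b j eq
    with Fin.<-cmp b s
  ... | tri< b<s _ _  = contradiction hole (s-least b<s)
  ... | tri≈ _ refl _ = j , refl , refl
  ... | tri> _ _ b>s  =
    contradiction (lookup-var⁺ s j nothing-at-s) (least (combine s j) (Fin.combine-monoˡ-< j j b>s))

  lineWord : NVariableWord d n (r * n)
  lineWord .word             = W
  lineWord .index            = toℕ
  lineWord .index-mono i<j   = i<j
  lineWord .index-occurs j   = combine s j , lookup-var⁺ s j nothing-at-s
  lineWord .index-complete (t , eq) with b , j , refl ← Fin.combine-surjective {r} {n} t =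
    j , proj₂ (lookup-var⁻ b j eq)
  -- Both first occurrences lie in block `s`, where offset equals variable index.
  lineWord .first-mono m<m′ F F′ with j , refl , refl ← first⁻ F | j′ , refl , refl ← first⁻ F′ =
    subst₂ _<_ (sym (Fin.toℕ-combine s j)) (sym (Fin.toℕ-combine s j′))
      (ℕ.+-monoʳ-< (n * toℕ s) m<m′)

  lineWord-first : FirstOccurrences W ≐ (λ t → n * toℕ s ≤ toℕ t × toℕ t < n * toℕ s + n)
  lineWord-first = to , from
    where
    to : ∀ {t} → FirstOccurrences W t → n * toℕ s ≤ toℕ t × toℕ t < n * toℕ s + n
    to (m , F) with j , _ , refl ← first⁻ F rewrite Fin.toℕ-combine s j =
      ℕ.m≤m+n (n * toℕ s) (toℕ j) , ℕ.+-monoʳ-< (n * toℕ s) (Fin.toℕ<n j)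

    from : ∀ {t} → n * toℕ s ≤ toℕ t × toℕ t < n * toℕ s + n → FirstOccurrences W t
    from {t} (lower , upper) = toℕ j , subst (IsFirstOccurrence W (toℕ j)) sj≡t (first⁺ j)
      where
      i<n : toℕ t ∸ n * toℕ s < n
      i<n = ℕ.+-cancelˡ-< (n * toℕ s) _ n (subst (_< n * toℕ s + n) (sym (ℕ.m+[n∸m]≡n lower)) upper)

      j : Fin n
      j = fromℕ< i<n

      sj≡t : combine s j ≡ t
      sj≡t = Fin.toℕ-injective (begin
        toℕ (combine s j)                        ≡⟨ Fin.toℕ-combine s j ⟩
        n * toℕ s + toℕ j                        ≡⟨ cong (n * toℕ s +_) (Fin.toℕ-fromℕ< i<n) ⟩
        n * toℕ s + (toℕ t ∸ n * toℕ s)          ≡⟨ ℕ.m+[n∸m]≡n lower ⟩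
        toℕ t                                    ∎)
        where open ≡-Reasoning

  -- Substituting `a` for the variables fills every wildcard block with `a`, as does giving the line
  -- the letter `encode a`; the other blocks are fixed.
  lineWord-⟨⟩ : ∀ a → lineWord ⟨ a ⟩ ≡ expand decode (L ⟪ encode a ⟫)
  lineWord-⟨⟩ a = trans (tabulate-cong letter-lookup) (tabulate∘lookup _)
    where
    letter : Fin (r * n) → Fin d
    letter t = fill (lookup W t) (λ eq → proj₁ (index-complete lineWord (t , eq))) a

    letter-block : ∀ x b j → lookup (template L) b ≡ x →
                   letter (combine b j) ≡ lookup (decode (fromMaybe (encode a) x)) j
    letter-block nothing b j eq = begin
      letter (combine b j)            ≡⟨ fill-var (lookup-var⁺ b j eq) ⟩
      -- `index-complete` specifies its answer only through the index, here `toℕ`, whose injectivity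
      -- identifies it with `j`.
      lookup a (proj₁ found)          ≡⟨ cong (lookup a) (Fin.toℕ-injective (proj₂ found)) ⟩
      lookup a j                      ≡⟨ cong (λ w → lookup w j) (decode-encode a) ⟨
      lookup (decode (encode a)) j    ∎
      where
      open ≡-Reasoning
      found = index-complete lineWord (combine b j , lookup-var⁺ b j eq)
    letter-block (just i) b j eq = fill-con (begin
      lookup W (combine b j)                        ≡⟨ lookup-expand (block d n) (template L) b j ⟩
      lookup (block d n (lookup (template L) b)) j  ≡⟨ cong (λ x → lookup (block d n x) j) eq ⟩
      lookup (map con (decode i)) j                 ≡⟨ lookup-map j con (decode i) ⟩
      con (lookup (decode i) j)                     ∎)
      where open ≡-Reasoning

    letter-combine : ∀ b j → letter (combine b j) ≡
                             lookup (expand decode (L ⟪ encode a ⟫)) (combine b j)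
    letter-combine b j = begin
      letter (combine b j)
        ≡⟨ letter-block _ b j refl ⟩
      lookup (decode (fromMaybe (encode a) (lookup (template L) b))) j
        ≡⟨ cong (λ i → lookup (decode i) j) (lookup-map b (fromMaybe (encode a)) (template L)) ⟨
      lookup (decode (lookup (L ⟪ encode a ⟫) b)) j
        ≡⟨ lookup-expand decode (L ⟪ encode a ⟫) b j ⟨
      lookup (expand decode (L ⟪ encode a ⟫)) (combine b j)
        ∎
      where open ≡-Reasoning

    letter-lookup : ∀ t → letter t ≡ lookup (expand decode (L ⟪ encode a ⟫)) t
    letter-lookup t = let b , j , eq = Fin.combine-surjective {r} {n} t in
      subst (λ t → letter t ≡ lookup (expand decode (L ⟪ encode a ⟫)) t) eq (letter-combine b j)

-- Sections of the constant sequence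

-- Over the constant sequence the section length, the total length and the offset
-- are n, r n and n s only propositionally, so N, n and o are kept as parameters.
HomogeneousWord : (Word d N → Fin k) → (n o : ℕ) → Set
HomogeneousWord {d} {N} f n o =
  Σ (NVariableWord d n N) λ v →
    FirstOccurrences (word v) ≐ (λ t → o ≤ toℕ t × toℕ t < o + n) ×
    (∀ a b → f (v ⟨ a ⟩) ≡ f (v ⟨ b ⟩))

homogeneousWord : ∀ d k n → ∃[ r ] (∀ {N} → N ≡ r * n → (f : Word d N → Fin k) →
                  Σ (Fin r) λ s → HomogeneousWord f n (n * toℕ s))
homogeneousWord d k n with r , hj ← halesJewett (d ^ n) k = r , homogeneous
  where
  open ≡-Reasoning
  homogeneous : ∀ {N} → N ≡ r * n → (f : Word d N → Fin k) →
                Σ (Fin r) λ s → HomogeneousWord f n (n * toℕ s)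
  -- The colouring `f` is pulled back to words of length `r` over `d ^ n` letters.
  homogeneous refl f with L , mono ← hj (f ∘ expand decode) =
    blockIndex d n L , lineWord d n L , lineWord-first d n L , λ a b → begin
      f (lineWord d n L ⟨ a ⟩)                 ≡⟨ cong f (lineWord-⟨⟩ d n L a) ⟩
      f (expand decode (L ⟪ encode a ⟫))       ≡⟨ mono (encode a) (encode b) ⟩
      f (expand decode (L ⟪ encode b ⟫))       ≡⟨ cong f (lineWord-⟨⟩ d n L b) ⟨
      f (lineWord d n L ⟨ b ⟩)                 ∎

homogeneousWord⇒sectionallyHomogeneous :
  ∀ (ns : Vec ℕ r) (f : Word d (sum ns) → Fin k) {o} (s : Fin r) →
  lookup ns s ≡ n → offset ns s ≡ o → HomogeneousWord f n o → SectionallyHomogeneous ns f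
homogeneousWord⇒sectionallyHomogeneous ns f s refl refl homogeneous = s , homogeneous

sum-replicate : ∀ r n → sum (replicate r n) ≡ r * n
sum-replicate zero    n = refl
sum-replicate (suc r) n = cong (n +_) (sum-replicate r n)

offset-replicate : ∀ n (s : Fin r) → offset (replicate r n) s ≡ n * toℕ s
offset-replicate n zero    = sym (ℕ.*-zeroʳ n)
offset-replicate n (suc s) = trans (cong (n +_) (offset-replicate n s)) (sym (ℕ.*-suc n (toℕ s)))

proposition4p2 : ∀ (d k n : ℕ) .{{_ : NonZero d}} .{{_ : NonZero k}} .{{_ : NonZero n}} →
    ∃[ r ] ¬ ENSH d k (replicate r n)
proposition4p2 d k n with r , homogeneous ← homogeneousWord d k n =
  r , λ (f , ¬homogeneous) →
    let s , h = homogeneous (sum-replicate r n) f in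
    ¬homogeneous (homogeneousWord⇒sectionallyHomogeneous (replicate r n) f s
                    (lookup-replicate s n) (offset-replicate n s) h)
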